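{- The set of Gödel codes of $\omega$-true closed sentences is not recursively enumerable.
   Context: **Syntax.** Terms: $t::=v_i\mid\bot\mid\mathbf 0\mid\mathbf S t\mid t=t\mid\neg t\mid t\lor t\mid\lambda t\mid t\cdot t\mid\mathcal R\mid\mathcal A$ ($v_i$, $i\in\mathbb N$, de Bruijn variables; $\lambda$ is the only binder; application associates to the left). A closed sentence is a closed term. $\bot$ is a divergent constant, $\mathcal R$ the primitive recursor, $\mathcal A$ the universal quantifier. $\underline n=\mathbf S^n\mathbf 0$; $b[t]$ is the $\beta$-instance substituting $t$ for the outermost bound variable of $b$. Fix a standard Gödel coding of terms. **$\omega$-truth** (the $\omega$-completed semantics of the grounded arithmetic OGA). Let $\Downarrow$ be the least relation between closed terms and naturals such that: $\mathbf 0\Downarrow0$; $t\Downarrow n$ implies $\mathbf S t\Downarrow n+1$; if $t\Downarrow m$, $u\Downarrow n$ then $(t=u)\Downarrow1$ when $m=n$ and $(t=u)\Downarrow0$ when $m\ne n$; $t\Downarrow1$ implies $\neg t\Downarrow0$, and $t\Downarrow0$ implies $\neg t\Downarrow1$; $t\lor u\Downarrow1$ if $t\Downarrow1$ or $u\Downarrow1$, and $t\lor u\Downarrow0$ if $t\Downarrow0$ and $u\Downarrow0$; for any finite list of arguments $\vec s$: $b[t]\cdot\vec s\Downarrow n$ implies $(\lambda b)\cdot t\cdot\vec s\Downarrow n$; if $a\Downarrow0$ and $g\cdot\vec s\Downarrow n$ then $\mathcal R\cdot g\cdot h\cdot a\cdot\vec s\Downarrow n$; if $a\Downarrow k+1$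 and $h\cdot\underline k\cdot(\mathcal R\cdot g\cdot h\cdot\underline k)\cdot\vec s\Downarrow n$ then $\mathcal R\cdot g\cdot h\cdot a\cdot\vec s\Downarrow n$; $\mathcal A\cdot f\Downarrow1$ if $f\cdot\underline k\Downarrow1$ for all $k\in\mathbb N$; $\mathcal A\cdot f\Downarrow0$ if $f\cdot\underline k\Downarrow0$ for some $k$. A closed term $t$ is $\omega$-true if $t\Downarrow1$. -}

module Defs where

open import Data.Fin using (Fin; zero; suc; toℕ)
open import Data.List using (List; foldl)
open import Data.Nat using (ℕ; zero; suc; _+_; _<_)
open import Data.Product using (_×_; ∃-syntax)
open import Data.Vec using (Vec; []; _∷_; lookup)
open import Data.Vec.Relation.Binary.Pointwise.Inductive using (Pointwise)
open import Function using (_⇔_)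
open import Level using (0ℓ)
open import Relation.Binary.PropositionalEquality using (_≡_; _≢_)
open import Relation.Unary using (Pred)

infix  11 ƛ_
infixl 20 _·_ _·*_
infix  13 ¬̇_
infix  15 _≐_
infixr 12 _∨̇_
infix  40 _[_]
infix  4  _⇓_ _⟨_⟩↦_

-- De Bruijn terms whose free variables are among v₀, …, vₙ₋₁, v₀ being bound
-- by the nearest enclosing ƛ.

data Term (n : ℕ) : Set where
  var  : Fin n → Term n
  bot  : Term n
  𝟎    : Term n
  𝐒    : Term n → Term n
  _≐_  : Term n → Term n → Term n
  ¬̇_   : Term n → Term n
  _∨̇_  : Term n → Term n → Term n
  ƛ_   : Term (suc n) → Term n
  _·_  : Term n → Term n → Term n
  𝓡    : Term n
  𝓐    : Term n

Sentence : Set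
Sentence = Term 0

liftRen : ∀ {m n} → (Fin m → Fin n) → Fin (suc m) → Fin (suc n)
liftRen ρ zero    = zero
liftRen ρ (suc i) = suc (ρ i)

rename : ∀ {m n} → (Fin m → Fin n) → Term m → Term n
rename ρ (var i) = var (ρ i)
rename ρ bot     = bot
rename ρ 𝟎       = 𝟎
rename ρ (𝐒 t)   = 𝐒 (rename ρ t)
rename ρ (t ≐ u) = rename ρ t ≐ rename ρ u
rename ρ (¬̇ t)   = ¬̇ rename ρ t
rename ρ (t ∨̇ u) = rename ρ t ∨̇ rename ρ u
rename ρ (ƛ b)   = ƛ rename (liftRen ρ) b
rename ρ (t · u) = rename ρ t · rename ρ u
rename ρ 𝓡       = 𝓡
rename ρ 𝓐       = 𝓐

liftSub : ∀ {m n} → (Fin m → Term n) → Fin (suc m) → Term (suc n)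
liftSub σ zero    = var zero
liftSub σ (suc i) = rename suc (σ i)

subst : ∀ {m n} → (Fin m → Term n) → Term m → Term n
subst σ (var i) = σ i
subst σ bot     = bot
subst σ 𝟎       = 𝟎
subst σ (𝐒 t)   = 𝐒 (subst σ t)
subst σ (t ≐ u) = subst σ t ≐ subst σ u
subst σ (¬̇ t)   = ¬̇ subst σ t
subst σ (t ∨̇ u) = subst σ t ∨̇ subst σ u
subst σ (ƛ b)   = ƛ subst (liftSub σ) b
subst σ (t · u) = subst σ t · subst σ u
subst σ 𝓡       = 𝓡
subst σ 𝓐       = 𝓐

instantiate : ∀ {n} → Term n → Fin (suc n) → Term n
instantiate t zero    = t
instantiate t (suc i) = var i

_[_] : ∀ {n} → Term (suc n) → Term n → Term n
b [ t ] = subst (instantiate t) b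

numeral : ∀ {n} → ℕ → Term n
numeral zero    = 𝟎
numeral (suc k) = 𝐒 (numeral k)

_·*_ : ∀ {n} → Term n → List (Term n) → Term n
t ·* ts = foldl _·_ t ts

data _⇓_ : Sentence → ℕ → Set where
  ⇓-𝟎  : 𝟎 ⇓ 0
  ⇓-𝐒  : ∀ {t n} → t ⇓ n → 𝐒 t ⇓ suc n
  ⇓-≐₁ : ∀ {t u m n} → t ⇓ m → u ⇓ n → m ≡ n → (t ≐ u) ⇓ 1
  ⇓-≐₀ : ∀ {t u m n} → t ⇓ m → u ⇓ n → m ≢ n → (t ≐ u) ⇓ 0
  ⇓-¬₀ : ∀ {t} → t ⇓ 1 → (¬̇ t) ⇓ 0
  ⇓-¬₁ : ∀ {t} → t ⇓ 0 → (¬̇ t) ⇓ 1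
  ⇓-∨ˡ : ∀ {t u} → t ⇓ 1 → (t ∨̇ u) ⇓ 1
  ⇓-∨ʳ : ∀ {t u} → u ⇓ 1 → (t ∨̇ u) ⇓ 1
  ⇓-∨₀ : ∀ {t u} → t ⇓ 0 → u ⇓ 0 → (t ∨̇ u) ⇓ 0
  ⇓-β  : ∀ {b t n} ss → (b [ t ] ·* ss) ⇓ n → ((ƛ b) · t ·* ss) ⇓ n
  ⇓-𝓡₀ : ∀ {g h a n} ss → a ⇓ 0 → (g ·* ss) ⇓ n →
         (𝓡 · g · h · a ·* ss) ⇓ n
  ⇓-𝓡₊ : ∀ {g h a k n} ss → a ⇓ suc k →
         (h · numeral k · (𝓡 · g · h · numeral k) ·* ss) ⇓ n →
         (𝓡 · g · h · a ·* ss) ⇓ n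
  ⇓-𝓐₁ : ∀ {f} → (∀ k → (f · numeral k) ⇓ 1) → (𝓐 · f) ⇓ 1
  ⇓-𝓐₀ : ∀ {f} k → (f · numeral k) ⇓ 0 → (𝓐 · f) ⇓ 0

ωTrue : Pred Sentence 0ℓ
ωTrue t = t ⇓ 1

triangle : ℕ → ℕ
triangle zero    = 0
triangle (suc n) = suc n + triangle n

-- Cantor's bijection ℕ × ℕ → ℕ, (x + y)(x + y + 1)/2 + y.

pair : ℕ → ℕ → ℕ
pair x y = triangle (x + y) + y

⌜_⌝ : ∀ {n} → Term n → ℕ
⌜ var i ⌝ = pair 0 (toℕ i)
⌜ bot ⌝   = pair 1 0
⌜ 𝟎 ⌝     = pair 2 0
⌜ 𝐒 t ⌝   = pair 3 ⌜ t ⌝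
⌜ t ≐ u ⌝ = pair 4 (pair ⌜ t ⌝ ⌜ u ⌝)
⌜ ¬̇ t ⌝   = pair 5 ⌜ t ⌝
⌜ t ∨̇ u ⌝ = pair 6 (pair ⌜ t ⌝ ⌜ u ⌝)
⌜ ƛ b ⌝   = pair 7 ⌜ b ⌝
⌜ t · u ⌝ = pair 8 (pair ⌜ t ⌝ ⌜ u ⌝)
⌜ 𝓡 ⌝     = pair 9 0
⌜ 𝓐 ⌝     = pair 10 0

ωTruthCodes : Pred ℕ 0ℓ
ωTruthCodes c = ∃[ t ] ωTrue t × ⌜ t ⌝ ≡ c

-- Kleene's schemes for the k-ary partial recursive functions.

data PartialRec : ℕ → Set where
  zeroᶠ : PartialRec 0
  sucᶠ  : PartialRec 1
  proj  : ∀ {k} → Fin k → PartialRec k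
  comp  : ∀ {k l} → PartialRec l → Vec (PartialRec k) l → PartialRec k
  prec  : ∀ {k} → PartialRec k → PartialRec (suc (suc k)) → PartialRec (suc k)
  μ     : ∀ {k} → PartialRec (suc k) → PartialRec k

-- f ⟨ xs ⟩↦ y : the partial function f is defined at xs, with value y.  In
-- particular μ f is defined at xs only if f is defined at i ∷ xs for every i up
-- to its least zero.

data _⟨_⟩↦_ : ∀ {k} → PartialRec k → Vec ℕ k → ℕ → Set where
  ↦-zero  : zeroᶠ ⟨ [] ⟩↦ 0
  ↦-suc   : ∀ {x} → sucᶠ ⟨ x ∷ [] ⟩↦ suc x
  ↦-proj  : ∀ {k} {i : Fin k} {xs} → proj i ⟨ xs ⟩↦ lookup xs i
  ↦-comp  : ∀ {k l} {f : PartialRec l} {gs : Vec (PartialRec k) l} {xs ys z} →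
            Pointwise (λ g y → g ⟨ xs ⟩↦ y) gs ys → f ⟨ ys ⟩↦ z →
            comp f gs ⟨ xs ⟩↦ z
  ↦-prec₀ : ∀ {k} {f : PartialRec k} {g xs y} →
            f ⟨ xs ⟩↦ y → prec f g ⟨ 0 ∷ xs ⟩↦ y
  ↦-prec₊ : ∀ {k} {f : PartialRec k} {g xs n y z} →
            prec f g ⟨ n ∷ xs ⟩↦ y → g ⟨ n ∷ y ∷ xs ⟩↦ z →
            prec f g ⟨ suc n ∷ xs ⟩↦ z
  ↦-μ     : ∀ {k} {f : PartialRec (suc k)} {xs y} →
            (∀ i → i < y → ∃[ z ] f ⟨ i ∷ xs ⟩↦ suc z) →
            f ⟨ y ∷ xs ⟩↦ 0 → μ f ⟨ xs ⟩↦ y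

-- A set is recursively enumerable when it is the domain of a partial recursive
-- function.

RecursivelyEnumerable : Pred ℕ 0ℓ → Set
RecursivelyEnumerable P =
  ∃[ f ] (∀ n → P n ⇔ (∃[ y ] f ⟨ n ∷ [] ⟩↦ y))

{-# OPTIONS --safe #-}

-- A stage-bounded evaluator turns the domain of a partial recursive f into
-- { c | ∃ s, eval f s c ≠ 0 } with eval f total, and total functions obtained by
-- primitive recursion are represented by terms.  So there is a closed term D such
-- that, for c = ⌜ t ⌝, D · c is true exactly when eval f s ⌜ t · c ⌝ = 0 for all s.
-- Then D · ⌜ D ⌝ is true iff its code lies outside the domain of f, and f cannot
-- enumerate the truths.

module Submission where

open import Defs
open import Data.Fin using (Fin; zero; suc; toℕ)
open import Data.Fin.Properties using (toℕ-injective)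
open import Data.List using (List; []; _∷_)
open import Data.Nat using (ℕ; zero; suc; pred; _+_; _≤_; _<_; _⊔_; s≤s; z≤n)
open import Data.Nat.Properties
open import Data.Product using (_×_; _,_; ∃-syntax; proj₂)
open import Data.Sum using (inj₁; inj₂)
open import Data.Unit using (⊤; tt)
open import Data.Vec using (Vec; []; _∷_; lookup; head; tail; map)
open import Data.Vec.Properties using (lookup-map)
open import Data.Vec.Relation.Binary.Pointwise.Inductive using (Pointwise; []; _∷_)
open import Function using (_∘_; id; _⇔_; mk⇔; Equivalence)
open import Relation.Binary.Definitions using (tri<; tri≈; tri>)
open import Relation.Binary.PropositionalEquality
  using (_≡_; _≢_; refl; sym; trans; cong; cong₂; module ≡-Reasoning)
  renaming (subst to transport)
open import Relation.Nullary using (¬_; contradiction)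

-- Substitution

private variable
  k l m n p : ℕ

-- The composite enters only through a pointwise equation, here and in the fusion laws below, so the
-- `ƛ` case passes to lifted maps without function extensionality.
rename-rename : {ρ₁ : Fin m → Fin n} {ρ₂ : Fin n → Fin p} {ρ₃ : Fin m → Fin p} →
                (∀ i → ρ₂ (ρ₁ i) ≡ ρ₃ i) →
                ∀ t → rename ρ₂ (rename ρ₁ t) ≡ rename ρ₃ t
rename-rename e (var i) = cong var (e i)
rename-rename e bot     = refl
rename-rename e 𝟎       = refl
rename-rename e (𝐒 t)   = cong 𝐒 (rename-rename e t)
rename-rename e (t ≐ u) = cong₂ _≐_ (rename-rename e t) (rename-rename e u)
rename-rename e (¬̇ t)   = cong ¬̇_ (rename-rename e t)
rename-rename e (t ∨̇ u) = cong₂ _∨̇_ (rename-rename e t) (rename-rename e u)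
rename-rename e (ƛ b)   = cong ƛ_ (rename-rename (λ { zero → refl ; (suc i) → cong suc (e i) }) b)
rename-rename e (t · u) = cong₂ _·_ (rename-rename e t) (rename-rename e u)
rename-rename e 𝓡       = refl
rename-rename e 𝓐       = refl

subst-rename : {ρ : Fin m → Fin n} {σ : Fin n → Term p} {τ : Fin m → Term p} →
               (∀ i → σ (ρ i) ≡ τ i) →
               ∀ t → subst σ (rename ρ t) ≡ subst τ t
subst-rename e (var i) = e i
subst-rename e bot     = refl
subst-rename e 𝟎       = refl
subst-rename e (𝐒 t)   = cong 𝐒 (subst-rename e t)
subst-rename e (t ≐ u) = cong₂ _≐_ (subst-rename e t) (subst-rename e u)
subst-rename e (¬̇ t)   = cong ¬̇_ (subst-rename e t)
subst-rename e (t ∨̇ u) = cong₂ _∨̇_ (subst-rename e t) (subst-rename e u)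
subst-rename e (ƛ b)   =
  cong ƛ_ (subst-rename (λ { zero → refl ; (suc i) → cong (rename suc) (e i) }) b)
subst-rename e (t · u) = cong₂ _·_ (subst-rename e t) (subst-rename e u)
subst-rename e 𝓡       = refl
subst-rename e 𝓐       = refl

rename-liftRen-suc : (ρ : Fin m → Fin n) (t : Term m) →
                     rename (liftRen ρ) (rename suc t) ≡ rename suc (rename ρ t)
rename-liftRen-suc ρ t =
  trans (rename-rename (λ _ → refl) t) (sym (rename-rename (λ _ → refl) t))

rename-subst : {σ : Fin m → Term n} {ρ : Fin n → Fin p} {τ : Fin m → Term p} →
               (∀ i → rename ρ (σ i) ≡ τ i) →
               ∀ t → rename ρ (subst σ t) ≡ subst τ t
rename-subst e (var i) = e i
rename-subst e bot     = refl
rename-subst e 𝟎       = refl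
rename-subst e (𝐒 t)   = cong 𝐒 (rename-subst e t)
rename-subst e (t ≐ u) = cong₂ _≐_ (rename-subst e t) (rename-subst e u)
rename-subst e (¬̇ t)   = cong ¬̇_ (rename-subst e t)
rename-subst e (t ∨̇ u) = cong₂ _∨̇_ (rename-subst e t) (rename-subst e u)
rename-subst {σ = σ} {ρ} e (ƛ b) = cong ƛ_ (rename-subst
  (λ { zero → refl ; (suc i) → trans (rename-liftRen-suc ρ (σ i)) (cong (rename suc) (e i)) }) b)
rename-subst e (t · u) = cong₂ _·_ (rename-subst e t) (rename-subst e u)
rename-subst e 𝓡       = refl
rename-subst e 𝓐       = refl

subst-liftSub-suc : (σ : Fin m → Term n) (t : Term m) →
                    subst (liftSub σ) (rename suc t) ≡ rename suc (subst σ t)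
subst-liftSub-suc σ t =
  trans (subst-rename (λ _ → refl) t) (sym (rename-subst (λ _ → refl) t))

subst-subst : {σ₁ : Fin m → Term n} {σ₂ : Fin n → Term p} {τ : Fin m → Term p} →
              (∀ i → subst σ₂ (σ₁ i) ≡ τ i) →
              ∀ t → subst σ₂ (subst σ₁ t) ≡ subst τ t
subst-subst e (var i) = e i
subst-subst e bot     = refl
subst-subst e 𝟎       = refl
subst-subst e (𝐒 t)   = cong 𝐒 (subst-subst e t)
subst-subst e (t ≐ u) = cong₂ _≐_ (subst-subst e t) (subst-subst e u)
subst-subst e (¬̇ t)   = cong ¬̇_ (subst-subst e t)
subst-subst e (t ∨̇ u) = cong₂ _∨̇_ (subst-subst e t) (subst-subst e u)
subst-subst {σ₁ = σ₁} {σ₂} e (ƛ b) = cong ƛ_ (subst-subst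
  (λ { zero → refl ; (suc i) → trans (subst-liftSub-suc σ₂ (σ₁ i)) (cong (rename suc) (e i)) }) b)
subst-subst e (t · u) = cong₂ _·_ (subst-subst e t) (subst-subst e u)
subst-subst e 𝓡       = refl
subst-subst e 𝓐       = refl

subst-id : {σ : Fin n → Term n} → (∀ i → σ i ≡ var i) → ∀ t → subst σ t ≡ t
subst-id e (var i) = e i
subst-id e bot     = refl
subst-id e 𝟎       = refl
subst-id e (𝐒 t)   = cong 𝐒 (subst-id e t)
subst-id e (t ≐ u) = cong₂ _≐_ (subst-id e t) (subst-id e u)
subst-id e (¬̇ t)   = cong ¬̇_ (subst-id e t)
subst-id e (t ∨̇ u) = cong₂ _∨̇_ (subst-id e t) (subst-id e u)
subst-id e (ƛ b)   = cong ƛ_ (subst-id (λ { zero → refl ; (suc i) → cong (rename suc) (e i) }) b)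
subst-id e (t · u) = cong₂ _·_ (subst-id e t) (subst-id e u)
subst-id e 𝓡       = refl
subst-id e 𝓐       = refl

weaken-[] : (t u : Term n) → rename suc t [ u ] ≡ t
weaken-[] t u = trans (subst-rename (λ _ → refl) t) (subst-id (λ _ → refl) t)

-- Serves the parameters of a primitive recursion, which stand under the two binders of the step
-- term and must survive both β-steps.
weaken²-[] : (t u v : Term n) →
             subst (liftSub (instantiate u)) (rename suc (rename suc t)) [ v ] ≡ t
weaken²-[] t u v = begin
  subst (liftSub (instantiate u)) (rename suc (rename suc t)) [ v ]
    ≡⟨ cong (_[ v ]) (subst-liftSub-suc (instantiate u) (rename suc t)) ⟩
  rename suc (rename suc t [ u ]) [ v ]  ≡⟨ weaken-[] _ v ⟩
  rename suc t [ u ]                     ≡⟨ weaken-[] t u ⟩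
  t                                      ∎
  where open ≡-Reasoning

-- Evaluation with an explicit argument stack

-- Run t ss n is (t ·* ss) ⇓ n with constructor-headed indices, which makes
-- inversion by pattern matching possible.
data Run : Sentence → List Sentence → ℕ → Set where
  run-· : ∀ {t u ss n} → Run t (u ∷ ss) n → Run (t · u) ss n
  run-𝟎 : Run 𝟎 [] 0
  run-𝐒 : ∀ {t n} → Run t [] n → Run (𝐒 t) [] (suc n)
  run-≐₁ : ∀ {t u m n} → Run t [] m → Run u [] n → m ≡ n → Run (t ≐ u) [] 1
  run-≐₀ : ∀ {t u m n} → Run t [] m → Run u [] n → m ≢ n → Run (t ≐ u) [] 0
  run-¬₀ : ∀ {t} → Run t [] 1 → Run (¬̇ t) [] 0
  run-¬₁ : ∀ {t} → Run t [] 0 → Run (¬̇ t) [] 1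
  run-∨ˡ : ∀ {t u} → Run t [] 1 → Run (t ∨̇ u) [] 1
  run-∨ʳ : ∀ {t u} → Run u [] 1 → Run (t ∨̇ u) [] 1
  run-∨₀ : ∀ {t u} → Run t [] 0 → Run u [] 0 → Run (t ∨̇ u) [] 0
  run-β  : ∀ {b t ss n} → Run (b [ t ]) ss n → Run (ƛ b) (t ∷ ss) n
  run-𝓡₀ : ∀ {g h a ss n} → Run a [] 0 → Run g ss n → Run 𝓡 (g ∷ h ∷ a ∷ ss) n
  run-𝓡₊ : ∀ {g h a ss k n} → Run a [] (suc k) →
           Run h (numeral k ∷ 𝓡 · g · h · numeral k ∷ ss) n → Run 𝓡 (g ∷ h ∷ a ∷ ss) n
  run-𝓐₁ : ∀ {f} → (∀ k → Run f (numeral k ∷ []) 1) → Run 𝓐 (f ∷ []) 1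
  run-𝓐₀ : ∀ {f} k → Run f (numeral k ∷ []) 0 → Run 𝓐 (f ∷ []) 0

run-wind : ∀ {t n} ss → Run t ss n → Run (t ·* ss) [] n
run-wind []       r = r
run-wind (s ∷ ss) r = run-wind ss (run-· r)

run-unwind : ∀ {t n} ss → Run (t ·* ss) [] n → Run t ss n
run-unwind []       r = r
run-unwind (s ∷ ss) r with run-· r′ ← run-unwind ss r = r′

⇓⇒Run : ∀ {t n} → t ⇓ n → Run t [] n
⇓⇒Run ⇓-𝟎            = run-𝟎
⇓⇒Run (⇓-𝐒 d)        = run-𝐒 (⇓⇒Run d)
⇓⇒Run (⇓-≐₁ d e q)   = run-≐₁ (⇓⇒Run d) (⇓⇒Run e) q
⇓⇒Run (⇓-≐₀ d e q)   = run-≐₀ (⇓⇒Run d) (⇓⇒Run e) q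
⇓⇒Run (⇓-¬₀ d)       = run-¬₀ (⇓⇒Run d)
⇓⇒Run (⇓-¬₁ d)       = run-¬₁ (⇓⇒Run d)
⇓⇒Run (⇓-∨ˡ d)       = run-∨ˡ (⇓⇒Run d)
⇓⇒Run (⇓-∨ʳ d)       = run-∨ʳ (⇓⇒Run d)
⇓⇒Run (⇓-∨₀ d e)     = run-∨₀ (⇓⇒Run d) (⇓⇒Run e)
-- The induction hypothesis has the whole application with an empty stack. Unwinding exposes the
-- head, the stack rule applies there, and winding restores the spine.
⇓⇒Run (⇓-β ss d)     = run-wind (_ ∷ ss) (run-β (run-unwind ss (⇓⇒Run d)))
⇓⇒Run (⇓-𝓡₀ ss d e)  =
  run-wind (_ ∷ _ ∷ _ ∷ ss) (run-𝓡₀ (⇓⇒Run d) (run-unwind ss (⇓⇒Run e)))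
⇓⇒Run (⇓-𝓡₊ ss d e)  =
  run-wind (_ ∷ _ ∷ _ ∷ ss) (run-𝓡₊ (⇓⇒Run d) (run-unwind (_ ∷ _ ∷ ss) (⇓⇒Run e)))
⇓⇒Run (⇓-𝓐₁ d)       = run-· (run-𝓐₁ λ k → run-unwind (_ ∷ []) (⇓⇒Run (d k)))
⇓⇒Run (⇓-𝓐₀ k d)     = run-· (run-𝓐₀ k (run-unwind (_ ∷ []) (⇓⇒Run d)))

Run⇒⇓ : ∀ {t ss n} → Run t ss n → (t ·* ss) ⇓ n
-- `t ·* (u ∷ ss)` unfolds to `(t · u) ·* ss`, so a push corresponds to no rule of `_⇓_`.
Run⇒⇓ (run-· r)                 = Run⇒⇓ r
Run⇒⇓ run-𝟎                     = ⇓-𝟎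
Run⇒⇓ (run-𝐒 r)                 = ⇓-𝐒 (Run⇒⇓ r)
Run⇒⇓ (run-≐₁ r s q)            = ⇓-≐₁ (Run⇒⇓ r) (Run⇒⇓ s) q
Run⇒⇓ (run-≐₀ r s q)            = ⇓-≐₀ (Run⇒⇓ r) (Run⇒⇓ s) q
Run⇒⇓ (run-¬₀ r)                = ⇓-¬₀ (Run⇒⇓ r)
Run⇒⇓ (run-¬₁ r)                = ⇓-¬₁ (Run⇒⇓ r)
Run⇒⇓ (run-∨ˡ r)                = ⇓-∨ˡ (Run⇒⇓ r)
Run⇒⇓ (run-∨ʳ r)                = ⇓-∨ʳ (Run⇒⇓ r)
Run⇒⇓ (run-∨₀ r s)              = ⇓-∨₀ (Run⇒⇓ r) (Run⇒⇓ s)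
Run⇒⇓ (run-β {ss = ss} r)       = ⇓-β ss (Run⇒⇓ r)
Run⇒⇓ (run-𝓡₀ {ss = ss} r s)    = ⇓-𝓡₀ ss (Run⇒⇓ r) (Run⇒⇓ s)
Run⇒⇓ (run-𝓡₊ {ss = ss} r s)    = ⇓-𝓡₊ ss (Run⇒⇓ r) (Run⇒⇓ s)
Run⇒⇓ (run-𝓐₁ r)                = ⇓-𝓐₁ λ k → Run⇒⇓ (r k)
Run⇒⇓ (run-𝓐₀ k r)              = ⇓-𝓐₀ k (Run⇒⇓ r)

-- Rules that could give one head different values have premises that already disagree on a subterm;
-- `run-𝓐₁` and `run-𝓐₀` clash at the witness of the latter.
run-deterministic : ∀ {t ss m n} → Run t ss m → Run t ss n → m ≡ n
run-deterministic (run-· r) (run-· r′) = run-deterministic r r′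
run-deterministic run-𝟎 run-𝟎 = refl
run-deterministic (run-𝐒 r) (run-𝐒 r′) = cong suc (run-deterministic r r′)
run-deterministic (run-≐₁ _ _ _) (run-≐₁ _ _ _) = refl
run-deterministic (run-≐₁ r s refl) (run-≐₀ r′ s′ q) =
  contradiction (trans (sym (run-deterministic r r′)) (run-deterministic s s′)) q
run-deterministic (run-≐₀ r s q) (run-≐₁ r′ s′ refl) =
  contradiction (trans (run-deterministic r r′) (sym (run-deterministic s s′))) q
run-deterministic (run-≐₀ _ _ _) (run-≐₀ _ _ _) = refl
run-deterministic (run-¬₀ _) (run-¬₀ _) = refl
run-deterministic (run-¬₀ r) (run-¬₁ r′) = sym (run-deterministic r r′)
run-deterministic (run-¬₁ r) (run-¬₀ r′) = sym (run-deterministic r r′)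
run-deterministic (run-¬₁ _) (run-¬₁ _) = refl
run-deterministic (run-∨ˡ _) (run-∨ˡ _) = refl
run-deterministic (run-∨ˡ _) (run-∨ʳ _) = refl
run-deterministic (run-∨ˡ r) (run-∨₀ r′ _) = run-deterministic r r′
run-deterministic (run-∨ʳ _) (run-∨ˡ _) = refl
run-deterministic (run-∨ʳ _) (run-∨ʳ _) = refl
run-deterministic (run-∨ʳ r) (run-∨₀ _ r′) = run-deterministic r r′
run-deterministic (run-∨₀ r _) (run-∨ˡ r′) = run-deterministic r r′
run-deterministic (run-∨₀ _ r) (run-∨ʳ r′) = run-deterministic r r′
run-deterministic (run-∨₀ _ _) (run-∨₀ _ _) = refl
run-deterministic (run-β r) (run-β r′) = run-deterministic r r′
run-deterministic (run-𝓡₀ _ s) (run-𝓡₀ _ s′) = run-deterministic s s′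
run-deterministic (run-𝓡₀ r _) (run-𝓡₊ r′ _) with () ← run-deterministic r r′
run-deterministic (run-𝓡₊ r _) (run-𝓡₀ r′ _) with () ← run-deterministic r r′
run-deterministic (run-𝓡₊ r s) (run-𝓡₊ r′ s′) with refl ← run-deterministic r r′ =
  run-deterministic s s′
run-deterministic (run-𝓐₁ _) (run-𝓐₁ _) = refl
run-deterministic (run-𝓐₁ r) (run-𝓐₀ k r′) = run-deterministic (r k) r′
run-deterministic (run-𝓐₀ k r) (run-𝓐₁ r′) = run-deterministic r (r′ k)
run-deterministic (run-𝓐₀ _ _) (run-𝓐₀ _ _) = refl

run-numeral : ∀ n → Run (numeral n) [] n
run-numeral zero    = run-𝟎
run-numeral (suc n) = run-𝐒 (run-numeral n)

-- Representable functions

_⊩_ : (Fin k → Sentence) → Vec ℕ k → Set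
σ ⊩ xs = ∀ i → Run (σ i) [] (lookup xs i)

-- The arguments are arbitrary closed terms with the right values, not just numerals: β and `𝓡` pass
-- arguments unevaluated, and this makes composition plain substitution.
record Representable (φ : Vec ℕ k → ℕ) : Set where
  constructor _by_
  field
    term       : Term k
    represents : ∀ σ xs → σ ⊩ xs → Run (subst σ term) [] (φ xs)

record Representable* (γ : Vec ℕ k → Vec ℕ l) : Set where
  constructor _by_
  field
    terms      : Fin l → Term k
    represents : ∀ σ xs → σ ⊩ xs → (subst σ ∘ terms) ⊩ γ xs

representable-≗ : {φ ψ : Vec ℕ k → ℕ} → (∀ xs → φ xs ≡ ψ xs) →
                  Representable φ → Representable ψ
representable-≗ e (t by r) = t by λ σ xs s → transport (Run _ []) (e xs) (r σ xs s)

representable-0 : Representable {k} (λ _ → 0)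
representable-0 = 𝟎 by λ _ _ _ → run-𝟎

representable-suc : {φ : Vec ℕ k → ℕ} → Representable φ → Representable (λ xs → suc (φ xs))
representable-suc (t by r) = 𝐒 t by λ σ xs s → run-𝐒 (r σ xs s)

representable-const : ∀ c → Representable {k} (λ _ → c)
representable-const zero    = representable-0
representable-const (suc c) = representable-suc (representable-const c)

representable-lookup : {γ : Vec ℕ k → Vec ℕ l} (i : Fin l) →
                       Representable* γ → Representable (λ xs → lookup (γ xs) i)
representable-lookup i (ts by r) = ts i by λ σ xs s → r σ xs s i

representable-head : {γ : Vec ℕ k → Vec ℕ (suc l)} →
                     Representable* γ → Representable (λ xs → head (γ xs))
representable-head {γ = γ} R = representable-≗ (λ xs → lookup-zero (γ xs)) (representable-lookup zero R)
  where
  lookup-zero : ∀ {l} (xs : Vec ℕ (suc l)) → lookup xs zero ≡ head xs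
  lookup-zero (_ ∷ _) = refl

representable*-id : Representable* {k} (λ xs → xs)
representable*-id = var by λ _ _ s → s

representable*-[] : Representable* {k} (λ _ → [])
representable*-[] = (λ ()) by λ _ _ _ ()

representable*-∷ : {φ : Vec ℕ k → ℕ} {γ : Vec ℕ k → Vec ℕ l} →
                   Representable φ → Representable* γ → Representable* (λ xs → φ xs ∷ γ xs)
representable*-∷ (t by r) (ts by rs) =
  (λ { zero → t ; (suc i) → ts i }) by
  λ { σ xs s zero → r σ xs s ; σ xs s (suc i) → rs σ xs s i }

representable*-tail : {γ : Vec ℕ k → Vec ℕ (suc l)} →
                      Representable* γ → Representable* (λ xs → tail (γ xs))
representable*-tail {γ = γ} (ts by r) = (ts ∘ suc) by λ σ xs s i →
  transport (Run _ []) (lookup-suc (γ xs) i) (r σ xs s (suc i))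
  where
  lookup-suc : ∀ {l} (xs : Vec ℕ (suc l)) i → lookup xs (suc i) ≡ lookup (tail xs) i
  lookup-suc (_ ∷ _) _ = refl

representable-∘ : {φ : Vec ℕ l → ℕ} {γ : Vec ℕ k → Vec ℕ l} →
                  Representable φ → Representable* γ → Representable (λ xs → φ (γ xs))
representable-∘ (t by r) (ts by rs) = subst ts t by λ σ xs s →
  transport (λ u → Run u [] _) (sym (subst-subst (λ _ → refl) t)) (r _ _ (rs σ xs s))

primrec : ℕ → (ℕ → ℕ → ℕ) → ℕ → ℕ
primrec z s zero    = z
primrec z s (suc n) = s n (primrec z s n)

-- The step sees the recursive value before the predecessor: 𝓡 applies it to the
-- predecessor first, so the recursive value is the innermost bound variable.
representable-primrec :
  {g a : Vec ℕ k → ℕ} {h : Vec ℕ (suc (suc k)) → ℕ} →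
  Representable g → Representable h → Representable a →
  Representable (λ xs → primrec (g xs) (λ n y → h (y ∷ n ∷ xs)) (a xs))
representable-primrec {k} {g} {a} {h} (tg by rg) (th by rh) (ta by ra) =
  (𝓡 · tg · (ƛ ƛ th) · ta) by λ σ xs s → run σ xs s (a xs) (ra σ xs s)
  where
  module _ (σ : Fin k → Sentence) (xs : Vec ℕ k) (s : σ ⊩ xs) where
    -- The recursion argument is generalised to any term with value `n`: at the outset it is an
    -- instance of `ta`, in recursive calls a numeral.
    run : ∀ n {u} → Run u [] n →
          Run (𝓡 · subst σ tg · subst σ (ƛ ƛ th) · u) []
              (primrec (g xs) (λ n y → h (y ∷ n ∷ xs)) n)
    run zero    r = run-· (run-· (run-· (run-𝓡₀ r (rg σ xs s))))
    run (suc n) r = run-· (run-· (run-· (run-𝓡₊ r (run-β (run-β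
      (transport (λ u → Run u [] _) (sym fuse) (rh τ _ τ⊩)))))))
      where
      -- `w` is the recursive call, handed to the step unevaluated; `τ` collects `σ` and the two
      -- β-instances into one substitution.
      w = 𝓡 · subst σ tg · subst σ (ƛ ƛ th) · numeral n
      τ = λ i → subst (liftSub (instantiate (numeral n))) (liftSub (liftSub σ) i) [ w ]

      fuse : subst (liftSub (instantiate (numeral n))) (subst (liftSub (liftSub σ)) th) [ w ]
             ≡ subst τ th
      fuse = trans (cong (_[ w ]) (subst-subst (λ _ → refl) th)) (subst-subst (λ _ → refl) th)

      τ⊩ : τ ⊩ (primrec (g xs) (λ n y → h (y ∷ n ∷ xs)) n ∷ n ∷ xs)
      τ⊩ zero          = run n (run-numeral n)
      τ⊩ (suc zero)    =
        transport (λ u → Run u [] n) (sym (weaken-[] (numeral n) w)) (run-numeral n)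
      τ⊩ (suc (suc i)) =
        transport (λ u → Run u [] _) (sym (weaken²-[] (σ i) (numeral n) w)) (s i)

-- Case distinction between zero and successor, phrased through `primrec` so that `𝓡` can represent
-- it.
branch : ℕ → (ℕ → ℕ) → ℕ → ℕ
branch z s = primrec z (λ n _ → s n)

representable-branch :
  {g a : Vec ℕ k → ℕ} {h : Vec ℕ (suc k) → ℕ} →
  Representable g → Representable h → Representable a →
  Representable (λ xs → branch (g xs) (λ n → h (n ∷ xs)) (a xs))
representable-branch rg rh ra =
  representable-primrec rg (representable-∘ rh (representable*-tail representable*-id)) ra

representable-weaken : {φ : Vec ℕ k → ℕ} → Representable φ → Representable (λ xs → φ (tail xs))
representable-weaken r = representable-∘ r (representable*-tail representable*-id)

-- Stage-bounded evaluation of partial recursive functions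

-- Makes composition strict: an entry 0 stands for an argument without a result, and then the
-- composite has none either.
guard : Vec ℕ l → ℕ → ℕ
guard []       z = z
guard (v ∷ vs) z = branch 0 (λ _ → guard vs z) v

preds : Vec ℕ l → Vec ℕ l
preds = map pred

-- The state of an unbounded search with current value r at j: 0 if some earlier
-- value is missing, 1 if no zero has been met, suc (suc i) if i is the least zero.
search-step : ℕ → ℕ → ℕ → ℕ
search-step r j c =
  branch 0 (branch (branch 0 (branch (suc (suc j)) (λ _ → 1)) r) (λ i → suc (suc i))) c

-- The value is 0 if there is no result at stage s, and suc y if the result is y.
mutual
  eval : PartialRec k → ℕ → Vec ℕ k → ℕ
  eval zeroᶠ       s xs = 1
  eval sucᶠ        s xs = suc (suc (head xs))
  eval (proj i)    s xs = suc (lookup xs i)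
  -- `preds` undoes the shift by one. On a missing result it yields a spurious 0, which `guard` then
  -- discards.
  eval (comp f gs) s xs = guard (evals gs s xs) (eval f s (preds (evals gs s xs)))
  -- The branch propagates a missing recursive value and otherwise strips the shift before calling
  -- `g`.
  eval (prec f g)  s xs =
    primrec (eval f s (tail xs)) (λ n → branch 0 (λ y → eval g s (n ∷ y ∷ tail xs))) (head xs)
  -- Only here does the stage have an effect, as the number of candidates tried. `pred` merges the
  -- states "failed" and "still searching" into "no result" and sends the state of a least zero `i`
  -- to `suc i`.
  eval (μ f)       s xs = pred (search f s xs s)

  evals : Vec (PartialRec k) l → ℕ → Vec ℕ k → Vec ℕ l
  evals []       s xs = []
  evals (g ∷ gs) s xs = eval g s xs ∷ evals gs s xs

  search : PartialRec (suc k) → ℕ → Vec ℕ k → ℕ → ℕ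
  search f s xs = primrec 1 (λ j → search-step (eval f s (j ∷ xs)) j)

-- Representability of the evaluator

representable-guard : {γ : Vec ℕ k → Vec ℕ l} {φ : Vec ℕ k → ℕ} →
                      Representable* γ → Representable φ → Representable (λ xs → guard (γ xs) (φ xs))
representable-guard {l = zero}  {γ} rγ rφ = representable-≗ (λ xs → guard-[] (γ xs)) rφ
  where
  guard-[] : ∀ (vs : Vec ℕ 0) {z} → z ≡ guard vs z
  guard-[] [] = refl
representable-guard {l = suc l} {γ} rγ rφ =
  representable-≗ (λ xs → guard-∷ (γ xs))
    (representable-branch representable-0
      (representable-weaken (representable-guard (representable*-tail rγ) rφ))
      (representable-head rγ))
  where
  guard-∷ : ∀ (vs : Vec ℕ (suc l)) {z} → branch 0 (λ _ → guard (tail vs) z) (head vs) ≡ guard vs z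
  guard-∷ (_ ∷ _) = refl

representable-pred : {φ : Vec ℕ k → ℕ} → Representable φ → Representable (λ xs → pred (φ xs))
representable-pred {φ = φ} r =
  representable-≗ (λ xs → branch-pred (φ xs))
    (representable-branch representable-0 (representable-head representable*-id) r)
  where
  branch-pred : ∀ n → branch 0 id n ≡ pred n
  branch-pred zero    = refl
  branch-pred (suc n) = refl

representable*-preds : {γ : Vec ℕ k → Vec ℕ l} →
                       Representable* γ → Representable* (λ xs → preds (γ xs))
representable*-preds {γ = γ} r =
  (λ i → Representable.term (component i)) by λ σ xs s i → Representable.represents (component i) σ xs s
  where
  component : ∀ i → Representable (λ xs → lookup (preds (γ xs)) i)
  component i = representable-≗ (λ xs → sym (lookup-map i pred (γ xs)))
                  (representable-pred (representable-lookup i r))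

representable-search-step :
  {r j c : Vec ℕ k → ℕ} → Representable r → Representable j → Representable c →
  Representable (λ xs → search-step (r xs) (j xs) (c xs))
representable-search-step rr rj rc =
  representable-branch representable-0
    (representable-branch
      (representable-weaken (representable-branch representable-0
        (representable-branch
          (representable-weaken (representable-suc (representable-suc rj)))
          (representable-const 1)
          (representable-head representable*-id))
        rr))
      (representable-suc (representable-suc (representable-head representable*-id)))
      (representable-head representable*-id))
    rc

private
  drop² : Representable* {suc (suc k)} (λ v → tail (tail v))
  drop² = representable*-tail (representable*-tail representable*-id)

  drop³ : Representable* {suc (suc (suc k))} (λ v → tail (tail (tail v)))
  drop³ = representable*-tail drop²

mutual
  -- The stage is the first argument of the represented function, so a single term covers all stages
  -- and can be quantified by `𝓐`.
  representable-eval : (f : PartialRec k) → Representable (λ v → eval f (head v) (tail v))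
  representable-eval zeroᶠ = representable-const 1
  representable-eval sucᶠ =
    representable-suc (representable-suc
      (representable-head (representable*-tail representable*-id)))
  representable-eval (proj i) =
    representable-suc (representable-lookup i (representable*-tail representable*-id))
  representable-eval (comp f gs) =
    representable-guard (representable*-evals gs)
      (representable-∘ (representable-eval f)
        (representable*-∷ (representable-head representable*-id)
          (representable*-preds (representable*-evals gs))))
  representable-eval (prec f g) =
    representable-primrec
      (representable-∘ (representable-eval f)
        (representable*-∷ (representable-head representable*-id) drop²))
      (representable-branch representable-0
        -- The context lists the unshifted recursive value, the shifted one, the counter, the stage,
        -- the original recursion argument and the parameters.
        (representable-∘ (representable-eval g)
          (representable*-∷ (representable-head drop³)
          (representable*-∷ (representable-head drop²)
          (representable*-∷ (representable-head representable*-id)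
            (representable*-tail (representable*-tail drop³))))))
        (representable-head representable*-id))
      (representable-head (representable*-tail representable*-id))
  representable-eval (μ f) =
    representable-pred
      (representable-primrec (representable-const 1)
        -- The context lists the search state, the candidate, the stage and the parameters.
        (representable-search-step
          (representable-∘ (representable-eval f)
            (representable*-∷ (representable-head drop²)
            (representable*-∷ (representable-head (representable*-tail representable*-id)) drop³)))
          (representable-head (representable*-tail representable*-id))
          (representable-head representable*-id))
        (representable-head representable*-id))

  representable*-evals : (gs : Vec (PartialRec k) l) →
                         Representable* (λ v → evals gs (head v) (tail v))
  representable*-evals []       = representable*-[]
  representable*-evals (g ∷ gs) =
    representable*-∷ (representable-eval g) (representable*-evals gs)

-- Soundness of the evaluator

SearchState : PartialRec (suc k) → Vec ℕ k → ℕ → ℕ → Set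
-- A failed search certifies nothing; the other two states carry exactly the two kinds of evidence
-- that `↦-μ` combines or produces.
SearchState f xs j zero          = ⊤
SearchState f xs j (suc zero)    = ∀ i → i < j → ∃[ z ] f ⟨ i ∷ xs ⟩↦ suc z
SearchState f xs j (suc (suc y)) = μ f ⟨ xs ⟩↦ y

mutual
  eval-sound : (f : PartialRec k) (s : ℕ) (xs : Vec ℕ k) {y : ℕ} →
               eval f s xs ≡ suc y → f ⟨ xs ⟩↦ y
  eval-sound zeroᶠ       s []       refl = ↦-zero
  eval-sound sucᶠ        s (x ∷ []) refl = ↦-suc
  eval-sound (proj i)    s xs       refl = ↦-proj
  eval-sound (comp f gs) s xs       e    with gs↦ , e′ ← evals-sound gs s xs e =
    ↦-comp gs↦ (eval-sound f s _ e′)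
  eval-sound (prec f g)  s (n ∷ xs) e    = prec-sound f g s n xs e
  eval-sound (μ f)       s xs       e    with search f s xs s | search-sound f s xs s
  -- States 0 and 1 have predecessor 0, which `e` excludes.
  ... | suc (suc _) | μ↦ with refl ← e = μ↦

  evals-sound : (gs : Vec (PartialRec k) l) (s : ℕ) (xs : Vec ℕ k) {y z : ℕ} →
                guard (evals gs s xs) z ≡ suc y →
                Pointwise (λ g v → g ⟨ xs ⟩↦ v) gs (preds (evals gs s xs)) × z ≡ suc y
  evals-sound []       s xs e = [] , e
  evals-sound (g ∷ gs) s xs e with eval g s xs in q
  ... | suc v with gs↦ , e′ ← evals-sound gs s xs e = eval-sound g s xs q ∷ gs↦ , e′

  -- Split off from `eval-sound` for the inner induction on the recursion argument.
  prec-sound : (f : PartialRec k) (g : PartialRec (suc (suc k))) (s n : ℕ) (xs : Vec ℕ k) {y : ℕ} →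
               eval (prec f g) s (n ∷ xs) ≡ suc y → prec f g ⟨ n ∷ xs ⟩↦ y
  prec-sound f g s zero    xs e = ↦-prec₀ (eval-sound f s xs e)
  prec-sound f g s (suc n) xs e with eval (prec f g) s (n ∷ xs) in q
  ... | suc v = ↦-prec₊ (prec-sound f g s n xs q) (eval-sound g s _ e)

  search-sound : (f : PartialRec (suc k)) (s : ℕ) (xs : Vec ℕ k) (j : ℕ) →
                 SearchState f xs j (search f s xs j)
  search-sound f s xs zero    = λ _ ()
  search-sound f s xs (suc j) with search f s xs j | search-sound f s xs j
  ... | zero        | _ = tt
  ... | suc (suc y) | μ↦ = μ↦
  ... | suc zero    | below with eval f s (j ∷ xs) in q
  ...   | zero        = tt
  -- A shifted result 1 is the actual value 0, met while all earlier values were positive.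
  ...   | suc zero    = ↦-μ below (eval-sound f s _ q)
  ...   | suc (suc z) = λ i i<1+j → positive i (m<1+n⇒m<n∨m≡n i<1+j)
    where
    positive : ∀ i → _ → ∃[ z ] f ⟨ i ∷ xs ⟩↦ suc z
    positive i (inj₁ i<j)  = below i i<j
    positive i (inj₂ refl) = z , eval-sound f s _ q

-- Completeness of the evaluator

Eventually : (ℕ → Set) → Set
Eventually P = ∃[ S ] (∀ s → S ≤ s → P s)

eventually-always : {P : ℕ → Set} → (∀ s → P s) → Eventually P
eventually-always p = 0 , λ s _ → p s

eventually-map : {P Q : ℕ → Set} → (∀ {s} → P s → Q s) → Eventually P → Eventually Q
eventually-map h (S , p) = S , λ s le → h (p s le)

-- The larger threshold serves both. This is how the finitely many subcomputations of a halting
-- computation are brought to a common stage.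
eventually-map₂ : {P Q R : ℕ → Set} → (∀ {s} → P s → Q s → R s) →
                  Eventually P → Eventually Q → Eventually R
eventually-map₂ h (S , p) (T , q) =
  S ⊔ T , λ s le → h (p s (m⊔n≤o⇒m≤o S T le)) (q s (m⊔n≤o⇒n≤o S T le))

eventually-bounded : {P : ℕ → ℕ → Set} (y : ℕ) → (∀ i → i < y → Eventually (P i)) →
                     Eventually (λ s → ∀ i → i < y → P i s)
eventually-bounded zero    p = eventually-always λ _ _ ()
eventually-bounded {P} (suc y) p = eventually-map₂ {P = λ s → ∀ i → i < y → P i s} extend
  (eventually-bounded y λ i i<y → p i (m<n⇒m<1+n i<y)) (p y ≤-refl)
  where
  extend : ∀ {s} → (∀ i → i < y → P i s) → P y s → ∀ i → i < suc y → P i s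
  extend below here i i<1+y with m<1+n⇒m<n∨m≡n i<1+y
  ... | inj₁ i<y  = below i i<y
  ... | inj₂ refl = here

guard-map-suc : ∀ (ys : Vec ℕ l) {z} → guard (map suc ys) z ≡ z
guard-map-suc []       = refl
guard-map-suc (y ∷ ys) = guard-map-suc ys

preds-map-suc : (ys : Vec ℕ l) → preds (map suc ys) ≡ ys
preds-map-suc []       = refl
preds-map-suc (y ∷ ys) = cong (y ∷_) (preds-map-suc ys)

module _ (f : PartialRec (suc k)) (s : ℕ) (xs : Vec ℕ k) where

  search-below : ∀ j → (∀ i → i < j → ∃[ z ] eval f s (i ∷ xs) ≡ suc (suc z)) →
                 search f s xs j ≡ 1
  search-below zero    _ = refl
  search-below (suc j) p
    rewrite search-below j (λ i i<j → p i (m<n⇒m<1+n i<j)) | proj₂ (p j ≤-refl) = refl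

  -- The state leaves 1 when the candidate `y` is processed and is frozen from then on.
  search-above : ∀ y → (∀ i → i < y → ∃[ z ] eval f s (i ∷ xs) ≡ suc (suc z)) →
                 eval f s (y ∷ xs) ≡ 1 → ∀ j → y < j → search f s xs j ≡ suc (suc y)
  search-above y p e (suc j) y<1+j with m<1+n⇒m<n∨m≡n y<1+j
  ... | inj₁ y<j  rewrite search-above y p e j y<j = refl
  ... | inj₂ refl rewrite search-below y p | e = refl

mutual
  eval-complete : {f : PartialRec k} {xs : Vec ℕ k} {y : ℕ} →
                  f ⟨ xs ⟩↦ y → Eventually (λ s → eval f s xs ≡ suc y)
  eval-complete ↦-zero = eventually-always λ _ → refl
  eval-complete ↦-suc  = eventually-always λ _ → refl
  eval-complete ↦-proj = eventually-always λ _ → refl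
  eval-complete {xs = xs} (↦-comp {f = f} {gs} {ys = ys} gs↦ f↦) = eventually-map₂
    (λ {s} p q → trans
      (cong (λ vs → guard vs (eval f s (preds vs))) p)
      (trans (guard-map-suc ys) (trans (cong (eval f s) (preds-map-suc ys)) q)))
    (evals-complete gs↦) (eval-complete f↦)
  eval-complete (↦-prec₀ f↦) = eval-complete f↦
  eval-complete (↦-prec₊ {g = g} {xs} {n} r↦ g↦) = eventually-map₂
    (λ {s} p q → trans (cong (branch 0 (λ y → eval g s (n ∷ y ∷ xs))) p) q)
    (eval-complete r↦) (eval-complete g↦)
  eval-complete (↦-μ {f = f} {xs} {y} below f↦) = eventually-map₂
    (λ {s} (p , y<s) e → cong pred (search-above f s xs y p e s y<s))
    (eventually-map₂ _,_
      (eventually-bounded y λ i i<y → let z , i↦ = below i i<y in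
        eventually-map (z ,_) (eval-complete i↦))
      -- The stage also bounds the search, so it must exceed `y` for the zero to be reached.
      (suc y , λ _ le → le))
    (eval-complete f↦)

  evals-complete : {gs : Vec (PartialRec k) l} {xs : Vec ℕ k} {ys : Vec ℕ l} →
                   Pointwise (λ g y → g ⟨ xs ⟩↦ y) gs ys →
                   Eventually (λ s → evals gs s xs ≡ map suc ys)
  evals-complete []          = eventually-always λ _ → refl
  evals-complete (g↦ ∷ gs↦) =
    eventually-map₂ (cong₂ _∷_) (eval-complete g↦) (evals-complete gs↦)

-- Gödel codes

triangle-mono-≤ : m ≤ n → triangle m ≤ triangle n
triangle-mono-≤ z≤n       = z≤n
triangle-mono-≤ (s≤s m≤n) = +-mono-≤ (s≤s m≤n) (triangle-mono-≤ m≤n)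

-- Pairs are ordered by antidiagonal first: triangle d + y < triangle (d + 1) for y ≤ d.
pair-<-antidiagonal : ∀ x y x′ y′ → x + y < x′ + y′ → pair x y < pair x′ y′
pair-<-antidiagonal x y x′ y′ lt = begin-strict
  triangle (x + y) + y              ≤⟨ +-monoʳ-≤ (triangle (x + y)) (m≤n+m y x) ⟩
  triangle (x + y) + (x + y)        <⟨ n<1+n _ ⟩
  suc (triangle (x + y) + (x + y))  ≡⟨ cong suc (+-comm (triangle (x + y)) (x + y)) ⟩
  triangle (suc (x + y))            ≤⟨ triangle-mono-≤ lt ⟩
  triangle (x′ + y′)                ≤⟨ m≤m+n _ y′ ⟩
  pair x′ y′                        ∎
  where open ≤-Reasoning

-- Different antidiagonals occupy disjoint ranges of codes; on a common one, cancelling the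
-- triangular number leaves `y`, and the sum then gives `x`.
pair-injective : ∀ x y x′ y′ → pair x y ≡ pair x′ y′ → x ≡ x′ × y ≡ y′
pair-injective x y x′ y′ e with <-cmp (x + y) (x′ + y′)
... | tri< lt _ _ = contradiction e (<⇒≢ (pair-<-antidiagonal x y x′ y′ lt))
... | tri> _ _ gt = contradiction (sym e) (<⇒≢ (pair-<-antidiagonal x′ y′ x y gt))
... | tri≈ _ d _  = +-cancelʳ-≡ y x x′ (trans d (cong (x′ +_) (sym y≡y′))) , y≡y′
  where
  y≡y′ = +-cancelˡ-≡ (triangle (x + y)) y y′ (trans e (cong (λ d → triangle d + y′) (sym d)))

-- Factoring codes through `tag` and `payload` lets unequal tags dismiss all pairs of distinct
-- constructors, so injectivity only has to treat matching ones.
tag : Term n → ℕ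
tag (var i) = 0
tag bot     = 1
tag 𝟎       = 2
tag (𝐒 t)   = 3
tag (t ≐ u) = 4
tag (¬̇ t)   = 5
tag (t ∨̇ u) = 6
tag (ƛ b)   = 7
tag (t · u) = 8
tag 𝓡       = 9
tag 𝓐       = 10

payload : Term n → ℕ
payload (var i) = toℕ i
payload bot     = 0
payload 𝟎       = 0
payload (𝐒 t)   = ⌜ t ⌝
payload (t ≐ u) = pair ⌜ t ⌝ ⌜ u ⌝
payload (¬̇ t)   = ⌜ t ⌝
payload (t ∨̇ u) = pair ⌜ t ⌝ ⌜ u ⌝
payload (ƛ b)   = ⌜ b ⌝
payload (t · u) = pair ⌜ t ⌝ ⌜ u ⌝
payload 𝓡       = 0
payload 𝓐       = 0

⌜⌝-pair : (t : Term n) → ⌜ t ⌝ ≡ pair (tag t) (payload t)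
⌜⌝-pair (var i) = refl
⌜⌝-pair bot     = refl
⌜⌝-pair 𝟎       = refl
⌜⌝-pair (𝐒 t)   = refl
⌜⌝-pair (t ≐ u) = refl
⌜⌝-pair (¬̇ t)   = refl
⌜⌝-pair (t ∨̇ u) = refl
⌜⌝-pair (ƛ b)   = refl
⌜⌝-pair (t · u) = refl
⌜⌝-pair 𝓡       = refl
⌜⌝-pair 𝓐       = refl

mutual
  -- Membership in `ωTruthCodes` yields only some true sentence with the given code; injectivity
  -- identifies it with the intended one.
  ⌜⌝-injective : (t u : Term n) → ⌜ t ⌝ ≡ ⌜ u ⌝ → t ≡ u
  ⌜⌝-injective t u e =
    let same-tag , same-payload = pair-injective (tag t) (payload t) (tag u) (payload u)
          (trans (sym (⌜⌝-pair t)) (trans e (⌜⌝-pair u)))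
    in tag-payload-injective t u same-tag same-payload

  tag-payload-injective : (t u : Term n) → tag t ≡ tag u → payload t ≡ payload u → t ≡ u
  tag-payload-injective (var i) (var j)   _ e = cong var (toℕ-injective e)
  tag-payload-injective bot     bot       _ _ = refl
  tag-payload-injective 𝟎       𝟎         _ _ = refl
  tag-payload-injective (𝐒 t)   (𝐒 t′)    _ e = cong 𝐒 (⌜⌝-injective t t′ e)
  tag-payload-injective (t ≐ u) (t′ ≐ u′) _ e =
    let p , q = pair-injective ⌜ t ⌝ ⌜ u ⌝ ⌜ t′ ⌝ ⌜ u′ ⌝ e
    in cong₂ _≐_ (⌜⌝-injective t t′ p) (⌜⌝-injective u u′ q)
  tag-payload-injective (¬̇ t)   (¬̇ t′)    _ e = cong ¬̇_ (⌜⌝-injective t t′ e)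
  tag-payload-injective (t ∨̇ u) (t′ ∨̇ u′) _ e =
    let p , q = pair-injective ⌜ t ⌝ ⌜ u ⌝ ⌜ t′ ⌝ ⌜ u′ ⌝ e
    in cong₂ _∨̇_ (⌜⌝-injective t t′ p) (⌜⌝-injective u u′ q)
  tag-payload-injective (ƛ b)   (ƛ b′)    _ e = cong ƛ_ (⌜⌝-injective b b′ e)
  tag-payload-injective (t · u) (t′ · u′) _ e =
    let p , q = pair-injective ⌜ t ⌝ ⌜ u ⌝ ⌜ t′ ⌝ ⌜ u′ ⌝ e
    in cong₂ _·_ (⌜⌝-injective t t′ p) (⌜⌝-injective u u′ q)
  tag-payload-injective 𝓡       𝓡         _ _ = refl
  tag-payload-injective 𝓐       𝓐         _ _ = refl

-- Representability of the coding

representable-+ : {φ ψ : Vec ℕ k → ℕ} → Representable φ → Representable ψ →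
                  Representable (λ xs → φ xs + ψ xs)
representable-+ {φ = φ} {ψ} rφ rψ =
  representable-≗ (λ xs → primrec-+ (φ xs) (ψ xs))
    (representable-primrec rψ (representable-suc (representable-head representable*-id)) rφ)
  where
  primrec-+ : ∀ m n → primrec n (λ _ → suc) m ≡ m + n
  primrec-+ zero    n = refl
  primrec-+ (suc m) n = cong suc (primrec-+ m n)

representable-triangle : {φ : Vec ℕ k → ℕ} → Representable φ →
                         Representable (λ xs → triangle (φ xs))
representable-triangle {φ = φ} r =
  representable-≗ (λ xs → primrec-triangle (φ xs))
    (representable-primrec representable-0
      (representable-+
        (representable-suc (representable-head (representable*-tail representable*-id)))
        (representable-head representable*-id))
      r)
  where
  primrec-triangle : ∀ n → primrec 0 (λ m y → suc m + y) n ≡ triangle n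
  primrec-triangle zero    = refl
  primrec-triangle (suc n) = cong (suc n +_) (primrec-triangle n)

representable-pair : {φ ψ : Vec ℕ k → ℕ} → Representable φ → Representable ψ →
                     Representable (λ xs → pair (φ xs) (ψ xs))
representable-pair rφ rψ =
  representable-+ (representable-triangle (representable-+ rφ rψ)) rψ

⌜numeral⌝ : ℕ → ℕ
⌜numeral⌝ n = ⌜ numeral {0} n ⌝

representable-⌜numeral⌝ : {φ : Vec ℕ k → ℕ} → Representable φ →
                          Representable (λ xs → ⌜numeral⌝ (φ xs))
representable-⌜numeral⌝ {φ = φ} r =
  representable-≗ (λ xs → primrec-⌜numeral⌝ (φ xs))
    (representable-primrec (representable-const (pair 2 0))
      (representable-pair (representable-const 3) (representable-head representable*-id)) r)
  where
  primrec-⌜numeral⌝ : ∀ n → primrec (pair 2 0) (λ _ → pair 3) n ≡ ⌜numeral⌝ n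
  primrec-⌜numeral⌝ zero    = refl
  primrec-⌜numeral⌝ (suc n) = cong (pair 3) (primrec-⌜numeral⌝ n)

-- The diagonal function: the code of a term goes to the code of that term applied to the numeral of
-- its own code.
diag : ℕ → ℕ
diag c = pair 8 (pair c (⌜numeral⌝ c))

representable-diag : {φ : Vec ℕ k → ℕ} → Representable φ → Representable (λ xs → diag (φ xs))
representable-diag r =
  representable-pair (representable-const 8) (representable-pair r (representable-⌜numeral⌝ r))

⌜·⌝-diag : (t : Sentence) → diag ⌜ t ⌝ ≡ ⌜ t · numeral ⌜ t ⌝ ⌝
⌜·⌝-diag t = refl

-- The diagonal sentence

module Vanishing
  {ψ : ℕ → ℕ → ℕ} (R : Representable {2} (λ v → ψ (head v) (head (tail v)))) where

  open Representable R renaming (term to q)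

  vanishes : Sentence
  -- The outer binder receives the code and the inner one the stage, so the stage is the variable 0
  -- of `q`, as the argument order of `ψ` demands.
  vanishes = ƛ (𝓐 · (ƛ (q ≐ 𝟎)))

  module _ (c : ℕ) where
    run-instance : ∀ s → Run (subst (liftSub (instantiate (numeral c))) q [ numeral s ]) [] (ψ s c)
    run-instance s = transport (λ u → Run u [] (ψ s c)) (sym (subst-subst (λ _ → refl) q))
      (represents _ (s ∷ c ∷ []) λ
        { zero       → run-numeral s
        -- The numeral of `c` was substituted beneath the inner binder and therefore arrives
        -- weakened.
        ; (suc zero) → transport (λ u → Run u [] c)
            (sym (weaken-[] (numeral c) (numeral s))) (run-numeral c) })

    vanishes-true : (∀ s → ψ s c ≡ 0) → ωTrue (vanishes · numeral c)
    vanishes-true ψ≡0 = Run⇒⇓ (run-· (run-β (run-· (run-𝓐₁ λ s →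
      run-β (run-≐₁ (run-instance s) run-𝟎 (ψ≡0 s))))))

    vanishes-true⁻¹ : ωTrue (vanishes · numeral c) → ∀ s → ψ s c ≡ 0
    vanishes-true⁻¹ d s
      with run-· (run-β (run-· (run-𝓐₁ r))) ← ⇓⇒Run d
      -- A true equation with right side `𝟎` gives its left side the value 0, and determinism
      -- carries this over to `ψ s c`.
      with run-β (run-≐₁ r₁ run-𝟎 refl) ← r s = run-deterministic (run-instance s) r₁

-- D is kept a variable: conversion would otherwise unfold its enormous unary code.
diagonal-contradiction :
  (f : PartialRec 1) (D : Sentence) →
  (∀ c → ωTrue (D · numeral c) ⇔ (∀ s → eval f s (diag c ∷ []) ≡ 0)) →
  ¬ (∀ n → ωTruthCodes n ⇔ (∃[ y ] f ⟨ n ∷ [] ⟩↦ y))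
diagonal-contradiction f D D-spec enumerates = ¬G-true G-true
  where
  G : Sentence
  G = D · numeral ⌜ D ⌝

  G-spec : ωTrue G ⇔ (∀ s → eval f s (⌜ G ⌝ ∷ []) ≡ 0)
  G-spec = transport (λ d → ωTrue G ⇔ (∀ s → eval f s (d ∷ []) ≡ 0)) (⌜·⌝-diag D) (D-spec ⌜ D ⌝)

  ¬G-true : ¬ ωTrue G
  ¬G-true G⇓1 =
    let y , f↦    = Equivalence.to (enumerates ⌜ G ⌝) (G , G⇓1 , refl)
        S , halts = eval-complete f↦
    in contradiction (trans (sym (Equivalence.to G-spec G⇓1 S)) (halts S ≤-refl)) 0≢1+n

  -- Whether a stage gives 0 is decidable, so the argument is constructive: a nonzero stage would
  -- put the code of `G` in the domain of `f`, making `G` true.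
  never-halts : ∀ s → eval f s (⌜ G ⌝ ∷ []) ≡ 0
  never-halts s with eval f s (⌜ G ⌝ ∷ []) in halts
  ... | zero  = refl
  ... | suc y with t , t⇓1 , e ← Equivalence.from (enumerates ⌜ G ⌝) (y , eval-sound f s _ halts) =
    contradiction (transport ωTrue (⌜⌝-injective t G e) t⇓1) ¬G-true

  G-true : ωTrue G
  G-true = Equivalence.from G-spec never-halts

mainTheorem6 : ¬ RecursivelyEnumerable ωTruthCodes
mainTheorem6 (f , enumerates) =
  diagonal-contradiction f vanishes (λ c → mk⇔ (vanishes-true⁻¹ c) (vanishes-true c)) enumerates
  where
  -- Diagonalisation is built into `ψ`: at code `c` it runs `f` on `diag c`.
  open Vanishing {λ s c → eval f s (diag c ∷ [])}
    (representable-∘ (representable-eval f)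
      (representable*-∷ (representable-head representable*-id)
      (representable*-∷
        (representable-diag (representable-head (representable*-tail representable*-id)))
        representable*-[])))
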